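{- Let $G$ be a snark, let $\sigma$ be a normal $5$-edge-coloring of $G$, let $C=u_0u_1\cdots u_{g-1}u_0$ be a cycle of length $g$ in $G$, and let $\tilde G$ be a superposition of $G$ along $C$ (as described in the context) determined by supervertex types $\mathcal{A}_i\in\{A,A'\}$, right semiedge permutations $p_i$ and docks $d_i\in\{1,2,3\}$, $i\in\{0,\ldots,g-1\}$. If there exists at least one $i\in\{0,\ldots,g-1\}$ such that $p_i(1)\neq 1$ or $d_i\neq 1$, then there exists a normal $5$-edge-coloring $\tilde\sigma$ of $\tilde G$ with at least $18$ poor edges.
   Context: A snark is a bridgeless cubic graph that is not $3$-edge-colorable. A (proper) $k$-edge-coloring of a graph is a map $\sigma:E\to\{1,\ldots,k\}$ with adjacent edges receiving distinct colors; $\sigma(v)$ denotes the set of colors of the edges incident to $v$. An edge $uv$ is poor if $|\sigma(u)\cup\sigma(v)|=3$ and rich if $|\sigma(u)\cup\sigma(v)|=5$; a proper edge-coloring of a cubic graph is normal if every edge is poor or rich. Petersen superedge: let $P_{10}$ be the Petersen graph, $u,v$ two nonadjacent vertices of $P_{10}$, and $x$ their unique common neighbor. The superedge $(P_{10})_{u,v}$ is obtained by deleting $u$ and $v$ and replacing each of the six edges formerly incident to $u$ or $v$ by a semiedge (a dangling edge) at its remaining endpoint. The three semiedges coming from edges at $u$ are the left semiedges $s^l_1,s^l_2,s^l_3$, where $s^l_1$ is the one at $x$; the three coming from edges at $v$ are the right semiedges $s^r_1,s^r_2,s^r_3$, where $s^r_1$ is the one at $x$. Superposition along a cycle: let $G$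 be a snark and $C=u_0u_1\cdots u_{g-1}u_0$ a cycle in $G$, indices taken modulo $g$. Put $e_i=u_iu_{i+1}$, let $v_i$ be the neighbor of $u_i$ other than $u_{i-1},u_{i+1}$, and $f_i=u_iv_i$. For each $i$ choose a copy $\mathcal{B}_i$ of $(P_{10})_{u,v}$, a permutation $p_i$ of $\{1,2,3\}$ (the right semiedge permutation), a dock $d_i\in\{1,2,3\}$, and a type $\mathcal{A}_i\in\{A,A'\}$. The graph $\tilde G$ is obtained as follows: delete the vertices of $C$ from $G$ (all other vertices and edges are kept; $f_i$ now dangles at $v_i$); for every $i$ and $j\in\{1,2,3\}$, identify the right semiedge $s^r_j$ of $\mathcal{B}_{i-1}$ with the left semiedge $s^l_{p_{i-1}(j)}$ of $\mathcal{B}_i$ to form an edge; the edge so formed with $p_{i-1}(j)=d_i$ is subdivided by a new vertex $u_i$, which is joined to $v_i$. If $\mathcal{A}_i=A$, the other two edges formed between $\mathcal{B}_{i-1}$ and $\mathcal{B}_i$ are left as they are; if $\mathcal{A}_i=A'$, each of these two edges is subdivided by a new vertex, $u_i'$ and $u_i''$ respectively, and the edge $u_i'u_i''$ is added. The result $\tilde G$ is a cubic graph. -}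

module Defs where

open import Data.Nat as ℕ using (ℕ; zero; suc; _+_; _∸_; _%_; _<ᵇ_; _≡ᵇ_)
open import Data.Nat.DivMod using (m%n<n)
open import Data.Bool using (Bool; true; false; _∧_; _∨_; T)
open import Data.Fin using (Fin; toℕ; fromℕ<; #_)
open import Data.Fin.Permutation using (Permutation′; _⟨$⟩ʳ_)
open import Data.Vec using (Vec; []; _∷_; lookup)
open import Data.Product using (Σ; ∃; ∃-syntax; _×_; _,_; swap)
open import Data.Sum using (_⊎_)
open import Relation.Binary.PropositionalEquality using (_≡_; _≢_)
open import Relation.Nullary using (¬_)
open import Function.Definitions using (Injective)

record Graph (n : ℕ) : Set₁ where
  field
    Adj   : Fin n → Fin n → Set
    sym   : ∀ {a b} → Adj a b → Adj b a
    irrefl : ∀ {a} → ¬ Adj a a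
open Graph public

Cubic : ∀ {n} → Graph n → Set
Cubic G = ∀ v → ∃[ a ] ∃[ b ] ∃[ c ]
  (Adj G v a × Adj G v b × Adj G v c × a ≢ b × a ≢ c × b ≢ c ×
   (∀ w → Adj G v w → (w ≡ a ⊎ w ≡ b ⊎ w ≡ c)))

data Reach {V : Set} (R : V → V → Set) : V → V → Set where
  here : ∀ {x} → Reach R x x
  step : ∀ {x y z} → R x y → Reach R y z → Reach R x z

DeleteEdge : ∀ {n} → Graph n → Fin n → Fin n → Fin n → Fin n → Set
DeleteEdge G a b x y = Adj G x y × ¬ ((x ≡ a × y ≡ b) ⊎ (x ≡ b × y ≡ a))

Bridgeless : ∀ {n} → Graph n → Set
Bridgeless G = ∀ a b → Adj G a b → Reach (DeleteEdge G a b) a b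

record EdgeColoring {V : Set} (Adj : V → V → Set) (k : ℕ) : Set where
  field
    col    : V → V → Fin k
    col-sym : ∀ {u v} → Adj u v → col u v ≡ col v u
    proper : ∀ {u v w} → Adj u v → Adj u w → v ≢ w → col u v ≢ col u w
open EdgeColoring public

Colorable : ∀ {V : Set} → (V → V → Set) → ℕ → Set
Colorable Adj k = EdgeColoring Adj k

Snark : ∀ {n} → Graph n → Set
Snark G = Cubic G × Bridgeless G × ¬ Colorable (Adj G) 3

ColorsAt : ∀ {V : Set} {Adj : V → V → Set} {k} → EdgeColoring Adj k → V → Fin k → Set
ColorsAt {Adj = Adj} σ v c = ∃[ w ] (Adj v w × col σ v w ≡ c)

HasSize : ∀ {k} → (Fin k → Set) → ℕ → Set
HasSize {k} P m = Σ (Fin m → Fin k) λ f →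
  Injective _≡_ _≡_ f × (∀ c → (P c → ∃[ i ] f i ≡ c) × (∃[ i ] f i ≡ c → P c))

UnionSize : ∀ {V : Set} {Adj : V → V → Set} {k} → EdgeColoring Adj k → V → V → ℕ → Set
UnionSize σ u v m = HasSize (λ c → ColorsAt σ u c ⊎ ColorsAt σ v c) m

Poor : ∀ {V : Set} {Adj : V → V → Set} {k} → EdgeColoring Adj k → V → V → Set
Poor σ u v = UnionSize σ u v 3

Rich : ∀ {V : Set} {Adj : V → V → Set} {k} → EdgeColoring Adj k → V → V → Set
Rich σ u v = UnionSize σ u v 5

Normal : ∀ {V : Set} {Adj : V → V → Set} {k} → EdgeColoring Adj k → Set
Normal {Adj = Adj} σ = ∀ u v → Adj u v → Poor σ u v ⊎ Rich σ u v

AtLeastPoor : ∀ {V : Set} {Adj : V → V → Set} {k} → EdgeColoring Adj k → ℕ → Set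
AtLeastPoor {V} {Adj} σ m = Σ (Fin m → V × V) λ f →
  (∀ i → let (a , b) = f i in Adj a b × Poor σ a b) ×
  (∀ i j → i ≢ j → f i ≢ f j × f i ≢ swap (f j))

next : ∀ {g} → Fin g → Fin g
next {suc k} i = fromℕ< (m%n<n (suc (toℕ i)) (suc k))

prev : ∀ {g} → Fin g → Fin g
prev {suc k} i = fromℕ< (m%n<n (toℕ i + k) (suc k))

IsCycle : ∀ {n} → Graph n → (g : ℕ) → (Fin g → Fin n) → Set
IsCycle G g u = (3 ℕ.≤ g) × Injective _≡_ _≡_ u × (∀ i → Adj G (u i) (u (next i)))

-- Petersen graph: outer 5-cycle 0..4, spokes i–(i+5), inner pentagram
-- (5+i)–(5+((i+2) mod 5)).

p10e : ℕ → ℕ → Bool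
p10e a b =
     ((a <ᵇ 5) ∧ (b <ᵇ 5) ∧ (b ≡ᵇ (suc a % 5)))
  ∨ ((a <ᵇ 5) ∧ (b ≡ᵇ (a + 5)))
  ∨ ((4 <ᵇ a) ∧ (4 <ᵇ b) ∧ ((b ∸ 5) ≡ᵇ (((a ∸ 5) + 2) % 5)))

P10Adj : Fin 10 → Fin 10 → Set
P10Adj a b = T (p10e (toℕ a) (toℕ b) ∨ p10e (toℕ b) (toℕ a))

-- Superedge (P10)_{u,v} with u = 0, v = 2, common neighbour x = 1.
-- Its 8 vertices, listed as vertices of P10: 1,3,4,5,6,7,8,9.
seVertex : Fin 8 → Fin 10
seVertex i = lookup (# 1 ∷ # 3 ∷ # 4 ∷ # 5 ∷ # 6 ∷ # 7 ∷ # 8 ∷ # 9 ∷ []) i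

SEAdj : Fin 8 → Fin 8 → Set
SEAdj a b = P10Adj (seVertex a) (seVertex b)

-- left semiedges (from edges at u = 0, whose neighbours are 1,4,5):
-- s^l_1 at x = 1, s^l_2 at 4, s^l_3 at 5  (given as indices into Fin 8)
leftEnd : Fin 3 → Fin 8
leftEnd j = lookup (# 0 ∷ # 2 ∷ # 3 ∷ []) j

-- right semiedges (from edges at v = 2, whose neighbours are 1,3,7):
-- s^r_1 at x = 1, s^r_2 at 3, s^r_3 at 7
rightEnd : Fin 3 → Fin 8
rightEnd j = lookup (# 0 ∷ # 1 ∷ # 5 ∷ []) j

data SType : Set where
  A A' : SType

-- for k ≠ d, which of the two non-dock edges k is: 0 (gets u') or 1 (gets u'')
slot : Fin 3 → Fin 3 → Fin 2
slot d k = lookup (lookup (lookup-row₀ ∷ lookup-row₁ ∷ lookup-row₂ ∷ []) d) k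
  where
  lookup-row₀ lookup-row₁ lookup-row₂ : Vec (Fin 2) 3
  lookup-row₀ = # 0 ∷ # 0 ∷ # 1 ∷ []
  lookup-row₁ = # 0 ∷ # 0 ∷ # 1 ∷ []
  lookup-row₂ = # 0 ∷ # 1 ∷ # 0 ∷ []

module Superposition {n : ℕ} (G : Graph n) (g : ℕ) (u : Fin g → Fin n)
  (ty : Fin g → SType) (p : Fin g → Permutation′ 3) (d : Fin g → Fin 3) where

  -- vertices of G̃: vertices of G (the new vertex u_i is identified with
  -- the old u_i, which after deleting the cycle edges keeps only f_i),
  -- the 8 vertices of each block B_i, and u_i', u_i'' when A_i = A'.
  data V : Set where
    old : Fin n → V
    blk : Fin g → Fin 8 → V
    ext : (i : Fin g) → ty i ≡ A' → Fin 2 → V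

  CycleEdge : Fin n → Fin n → Set
  CycleEdge a b = ∃[ i ] ((a ≡ u i × b ≡ u (next i)) ⊎ (b ≡ u i × a ≡ u (next i)))

  -- the junction between B_{i-1} and B_i: right semiedge s^r_j of B_{i-1}
  -- is joined with left semiedge s^l_{p_{i-1}(j)} of B_i
  data E : V → V → Set where
    oldE  : ∀ {a b} → Adj G a b → ¬ CycleEdge a b → E (old a) (old b)
    innerE : ∀ {i a b} → SEAdj a b → E (blk i a) (blk i b)
    dockL : ∀ i j → p (prev i) ⟨$⟩ʳ j ≡ d i →
            E (blk (prev i) (rightEnd j)) (old (u i))
    dockR : ∀ i j → p (prev i) ⟨$⟩ʳ j ≡ d i →
            E (old (u i)) (blk i (leftEnd (p (prev i) ⟨$⟩ʳ j)))
    plainE : ∀ i j → ty i ≡ A → p (prev i) ⟨$⟩ʳ j ≢ d i →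
            E (blk (prev i) (rightEnd j)) (blk i (leftEnd (p (prev i) ⟨$⟩ʳ j)))
    subL  : ∀ i j (h : ty i ≡ A') → p (prev i) ⟨$⟩ʳ j ≢ d i →
            E (blk (prev i) (rightEnd j)) (ext i h (slot (d i) (p (prev i) ⟨$⟩ʳ j)))
    subR  : ∀ i j (h : ty i ≡ A') → p (prev i) ⟨$⟩ʳ j ≢ d i →
            E (ext i h (slot (d i) (p (prev i) ⟨$⟩ʳ j))) (blk i (leftEnd (p (prev i) ⟨$⟩ʳ j)))
    extE  : ∀ i (h : ty i ≡ A') → E (ext i h (# 0)) (ext i h (# 1))

  Adj~ : V → V → Set
  Adj~ x y = E x y ⊎ E y x

{-# OPTIONS --safe #-}

-- Every vertex of G̃ is sent by a map ψ to a vertex of G: old vertices to themselves, the left part of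
-- block i to u_i, its right part to u_{i+1}, the vertices of junction i to u_i.
-- Each edge of G̃ then becomes a point or an edge of G, so a proper colouring showing at every x exactly the
-- colours that σ shows at ψ x is normal, and every edge contracted by ψ is poor.  Inside block i the edges
-- between the two parts, together with one "odd" left and one "odd" right semiedge, carry the colour α of e_i.
-- The blocks admit such colourings when exactly one of the two odd semiedges is the one at x, and when the odd
-- left semiedge is not at x and all right semiedges have colour α.  Each contracts at least 6 inner edges,
-- hence 3 · 6 = 18 poor edges.  A junction moves the odd position by a permutation depending on p, d and the
-- type, so the colourings match up around C if a walk of odd positions closes up.  Any position has a
-- predecessor, and a junction with p(1) ≠ 1 or d ≠ 1 can be entered from one fixed state whatever state
-- is to follow it; walking backwards once around C from there closes the walk.
module Submission where

open import Defs renaming (sym to Adj-sym)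
open import Data.Nat as ℕ using (ℕ; zero; suc; _+_; _%_; _≤_; z≤n; s≤s)
import Data.Nat.Properties as ℕ
open import Data.Nat.DivMod using (m<n⇒m%n≡m; n%n≡0; [m+n]%n≡m%n)
open import Data.Bool using (Bool; true; false; if_then_else_)
open import Data.Bool.Properties using (T?)
open import Data.Fin using (Fin; zero; suc; #_; _≟_; toℕ; inject₁; fromℕ; inject≤; opposite; remQuot; combine)
open import Data.Fin.Properties using (all?; any?; toℕ-injective; toℕ-fromℕ<; toℕ<n; toℕ≤pred[n]; toℕ-inject₁; toℕ-fromℕ; inject≤-injective; combine-remQuot)
open import Data.Fin.Permutation using (Permutation′; _⟨$⟩ʳ_; _⟨$⟩ˡ_; inverseʳ; inverseˡ)
open import Data.Maybe using (Maybe; just; nothing; map)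
open import Data.Product using (Σ; ∃; ∃-syntax; _×_; _,_; proj₁; proj₂; swap)
open import Data.Product.Properties using (≡-dec)
import Data.Sum
open import Data.Sum using (_⊎_; inj₁; inj₂)
open import Data.Empty using (⊥; ⊥-elim)
open import Data.Unit using (⊤)
open import Data.Vec using (Vec; []; _∷_; lookup)
open import Function using (_∘_)
open import Function.Definitions using (Injective)
open import Relation.Binary.PropositionalEquality
open import Relation.Nullary using (¬_; Dec; yes; no; does; ¬?; _×-dec_; _⊎-dec_; _→-dec_; contradiction)
open import Relation.Nullary.Decidable using (True; toWitness; map′)

-- Successor and predecessor on the cyclic index set.

next-view : ∀ {k} (i : Fin (suc k)) →
  (toℕ i ≡ k × toℕ (next i) ≡ 0) ⊎ toℕ (next i) ≡ suc (toℕ i)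
next-view {k} i with ℕ.m≤n⇒m<n∨m≡n (toℕ≤pred[n] i)
... | inj₁ i<k = inj₂ (trans (toℕ-fromℕ< _) (m<n⇒m%n≡m (s≤s i<k)))
... | inj₂ i≡k = inj₁ (i≡k , trans (toℕ-fromℕ< _)
                   (trans (cong (λ m → suc m % suc k) i≡k) (n%n≡0 (suc k))))

prev-view : ∀ {k} (i : Fin (suc k)) →
  (toℕ i ≡ 0 × toℕ (prev i) ≡ k) ⊎ toℕ i ≡ suc (toℕ (prev i))
prev-view {k} zero = inj₁ (refl , trans (toℕ-fromℕ< _) (m<n⇒m%n≡m ℕ.≤-refl))
prev-view {k} (suc i) = inj₂ (cong suc (sym (begin
  toℕ (prev (suc i))     ≡⟨ toℕ-fromℕ< _ ⟩
  suc (toℕ i + k) % suc k ≡⟨ cong (_% suc k) (ℕ.+-suc (toℕ i) k) ⟨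
  (toℕ i + suc k) % suc k ≡⟨ [m+n]%n≡m%n (toℕ i) (suc k) ⟩
  toℕ i % suc k          ≡⟨ m<n⇒m%n≡m (ℕ.m<n⇒m<1+n (toℕ<n i)) ⟩
  toℕ i                  ∎)))
  where open ≡-Reasoning

next-prev : ∀ {g} (i : Fin g) → next (prev i) ≡ i
next-prev {suc k} i with prev-view i | next-view (prev i)
... | inj₁ (i≡0 , _) | inj₁ (_ , n≡0) = toℕ-injective (trans n≡0 (sym i≡0))
... | inj₂ i≡1+p | inj₂ n≡1+p = toℕ-injective (trans n≡1+p (sym i≡1+p))
... | inj₁ (_ , p≡k) | inj₂ n≡1+p =
  ⊥-elim (ℕ.<-irrefl (trans n≡1+p (cong suc p≡k)) (toℕ<n (next (prev i))))
... | inj₂ i≡1+p | inj₁ (p≡k , _) =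
  ⊥-elim (ℕ.<-irrefl (trans i≡1+p (cong suc p≡k)) (toℕ<n i))

prev-next : ∀ {g} (i : Fin g) → prev (next i) ≡ i
prev-next {suc k} i with next-view i | prev-view (next i)
... | inj₁ (i≡k , _) | inj₁ (_ , p≡k) = toℕ-injective (trans p≡k (sym i≡k))
... | inj₂ n≡1+i | inj₂ n≡1+p = toℕ-injective (ℕ.suc-injective (trans (sym n≡1+p) n≡1+i))
... | inj₁ (_ , n≡0) | inj₂ n≡1+p = ⊥-elim (ℕ.1+n≢0 (trans (sym n≡1+p) n≡0))
... | inj₂ n≡1+i | inj₁ (n≡0 , _) = ⊥-elim (ℕ.1+n≢0 (trans (sym n≡1+i) n≡0))

next≢ : ∀ {g} → 3 ≤ g → (i : Fin g) → next i ≢ i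
next≢ {suc k} (s≤s 2≤k) i eq with next-view i
... | inj₁ (i≡k , n≡0) = ℕ.<-irrefl (trans (sym n≡0) (trans (cong toℕ eq) i≡k)) (ℕ.≤-trans (s≤s z≤n) 2≤k)
... | inj₂ n≡1+i = ℕ.1+n≢n (trans (sym n≡1+i) (cong toℕ eq))

next≢prev : ∀ {g} → 3 ≤ g → (i : Fin g) → next i ≢ prev i
next≢prev {suc k} (s≤s 2≤k) i eq with next-view i | prev-view i
... | inj₁ (_ , n≡0) | inj₁ (_ , p≡k) =
  ℕ.<-irrefl (trans (sym n≡0) (trans (cong toℕ eq) p≡k)) (ℕ.≤-trans (s≤s z≤n) 2≤k)
... | inj₁ (i≡k , n≡0) | inj₂ i≡1+p =
  ℕ.<-irrefl (trans (cong suc (trans (sym n≡0) (cong toℕ eq))) (trans (sym i≡1+p) i≡k)) 2≤k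
... | inj₂ n≡1+i | inj₁ (i≡0 , p≡k) =
  ℕ.<-irrefl (trans (trans (cong suc (sym i≡0)) (sym n≡1+i)) (trans (cong toℕ eq) p≡k)) 2≤k
... | inj₂ n≡1+i | inj₂ i≡1+p =
  ℕ.<-irrefl (trans (sym (cong toℕ eq)) (trans n≡1+i (cong suc i≡1+p)))
    (ℕ.m<n⇒m<1+n (ℕ.n<1+n _))

prev≢ : ∀ {g} → 3 ≤ g → (i : Fin g) → prev i ≢ i
prev≢ 3≤g i eq = next≢ 3≤g (prev i) (trans (next-prev i) (sym eq))

-- States chosen backwards around a cycle.

module _ {X : Set} where

  -- `F i` computes a state at i from the one at i+1, so the composition starts with `z` beyond the
  -- last index and runs backwards.
  scan : ∀ {g} → (Fin g → X → X) → X → Fin (suc g) → X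
  scan {zero}  F z _       = z
  scan {suc g} F z zero    = F zero (scan (λ i → F (suc i)) z zero)
  scan {suc g} F z (suc i) = scan (λ j → F (suc j)) z i

  scan-step : ∀ {g} (F : Fin g → X → X) z i →
    scan F z (inject₁ i) ≡ F i (scan F z (suc i))
  scan-step {suc g} F z zero    = refl
  scan-step {suc g} F z (suc i) = scan-step (λ j → F (suc j)) z i

  scan-last : ∀ {g} (F : Fin g → X → X) z → scan F z (fromℕ g) ≡ z
  scan-last {zero}  F z = refl
  scan-last {suc g} F z = scan-last (λ j → F (suc j)) z

  -- Whatever arrives from later indices is forgotten at `F k`.
  scan-const : ∀ {g} (F : Fin g → X → X) k → (∀ x y → F k x ≡ F k y) →
    ∀ z z′ → scan F z zero ≡ scan F z′ zero
  scan-const {suc g} F zero    const z z′ = const _ _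
  scan-const {suc g} F (suc k) const z z′ =
    cong (F zero) (scan-const (λ j → F (suc j)) k const z z′)

  -- F k is constant, so a scan once around the cycle returns the same value whatever it starts from.
  cyclic-fixpoint : ∀ {g} (F : Fin g → X → X) k → (∀ x y → F k x ≡ F k y) → X →
    Σ (Fin g → X) λ S → ∀ i → S i ≡ F i (S (next i))
  cyclic-fixpoint {suc g} F k const x₀ = S , λ i → trans (scan-step F z i) (cong (F i) (wrap i))
    where
    -- The result of one backward turn from an arbitrary state. As `F k` forgets its input, a turn
    -- that starts from `z` ends in `z` again.
    z = scan F x₀ zero
    S : Fin (suc g) → X
    S i = scan F z (inject₁ i)
    wrap : ∀ i → scan F z (suc i) ≡ S (next i)
    wrap i with next-view i
    ... | inj₁ (i≡g , n≡0) = begin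
      scan F z (suc i)         ≡⟨ cong (scan F z) (toℕ-injective (trans (cong suc i≡g) (sym (toℕ-fromℕ (suc g))))) ⟩
      scan F z (fromℕ (suc g)) ≡⟨ scan-last F z ⟩
      z                        ≡⟨ scan-const F k const x₀ z ⟩
      scan F z zero            ≡⟨ cong S {next i} {zero} (toℕ-injective n≡0) ⟨
      S (next i)               ∎
      where open ≡-Reasoning
    ... | inj₂ n≡1+i = cong (scan F z) (toℕ-injective (trans (sym n≡1+i) (sym (toℕ-inject₁ (next i)))))

-- Finite checks by evaluation, and triples.

-- The implicit argument is solved by evaluating the decision procedure, so each use below is an
-- exhaustive case check.
decided : ∀ {P : Set} (P? : Dec P) {_ : True P?} → P
decided P? {t} = toWitness t

tri : ∀ {X : Set} → X → X → X → Fin 3 → X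
tri x y z = lookup (x ∷ y ∷ z ∷ [])

tri-η : ∀ {X : Set} (f : Fin 3 → X) → tri (f (# 0)) (f (# 1)) (f (# 2)) ≗ f
tri-η f zero             = refl
tri-η f (suc zero)       = refl
tri-η f (suc (suc zero)) = refl

tri-injective : ∀ {X : Set} {x y z : X} → x ≢ y → x ≢ z → y ≢ z → Injective _≡_ _≡_ (tri x y z)
tri-injective xy xz yz {zero}           {zero}           eq = refl
tri-injective xy xz yz {zero}           {suc zero}       eq = ⊥-elim (xy eq)
tri-injective xy xz yz {zero}           {suc (suc zero)} eq = ⊥-elim (xz eq)
tri-injective xy xz yz {suc zero}       {zero}           eq = ⊥-elim (xy (sym eq))
tri-injective xy xz yz {suc zero}       {suc zero}       eq = refl
tri-injective xy xz yz {suc zero}       {suc (suc zero)} eq = ⊥-elim (yz eq)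
tri-injective xy xz yz {suc (suc zero)} {zero}           eq = ⊥-elim (xz (sym eq))
tri-injective xy xz yz {suc (suc zero)} {suc zero}       eq = ⊥-elim (yz (sym eq))
tri-injective xy xz yz {suc (suc zero)} {suc (suc zero)} eq = refl

tri-surjective : ∀ (x y z : Fin 3) → x ≢ y → x ≢ z → y ≢ z → ∀ w → ∃[ k ] tri x y z k ≡ w
tri-surjective = decided (all? λ x → all? λ y → all? λ z →
  ¬? (x ≟ y) →-dec ¬? (x ≟ z) →-dec ¬? (y ≟ z) →-dec all? λ w → any? λ k → tri x y z k ≟ w)

injective⇒surjective : (f : Fin 3 → Fin 3) → Injective _≡_ _≡_ f → ∀ w → ∃[ k ] f k ≡ w
injective⇒surjective f inj w =
  let k , eq = tri-surjective _ _ _ (λ e → 0≢1 (inj e)) (λ e → 0≢2 (inj e)) (λ e → 1≢2 (inj e)) w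
  in k , trans (sym (tri-η f k)) eq
  where
  0≢1 : # 0 ≢ # 1
  0≢1 ()
  0≢2 : # 0 ≢ # 2
  0≢2 ()
  1≢2 : # 1 ≢ # 2
  1≢2 ()

-- Colourings of the Petersen superedge.

-- Names of the edges e_{i-1}, e_i, f_i at u_i.
pattern back = zero
pattern fwd  = suc zero
pattern off  = suc (suc zero)

-- In block i, α stands for the colour of e_i, and β, γ for the two other colours at u_i (left part) or at
-- u_{i+1} (right part), in an order fixed by the junction.
pattern α = zero
pattern β = suc zero
pattern γ = suc (suc zero)

-- The colourings of a block: into has its odd left semiedge at x and its odd right semiedge elsewhere, outof
-- is the converse, and spread has its odd left semiedge away from x and all right semiedges coloured α.
data Scheme : Set where
  into outof spread : Fin 2 → Scheme

scheme? : ∀ {P : Scheme → Set} → (∀ s → Dec (P s)) → Dec (∀ s → P s)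
scheme? P? = map′ (λ { (f , g , h) (into o) → f o ; (f , g , h) (outof o) → g o ; (f , g , h) (spread o) → h o })
                  (λ f → (λ o → f (into o)) , (λ o → f (outof o)) , (λ o → f (spread o)))
  (all? (λ o → P? (into o)) ×-dec all? (λ o → P? (outof o)) ×-dec all? (λ o → P? (spread o)))

leftOdd : Scheme → Fin 3
leftOdd (into _)   = zero
leftOdd (outof o)  = suc o
leftOdd (spread o) = suc o

rightOdd : Scheme → Maybe (Fin 3)
rightOdd (into o)   = just (suc o)
rightOdd (outof _)  = just zero
rightOdd (spread _) = nothing

data Side : Set where
  L R : Side

_≟ˢ_ : (x y : Side) → Dec (x ≡ y)
L ≟ˢ L = yes refl
L ≟ˢ R = no λ ()
R ≟ˢ L = no λ ()
R ≟ˢ R = yes refl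

data Port : Set where
  inner      : Fin 8 → Port
  left right : Fin 3 → Port

_≟ᵖ_ : (x y : Port) → Dec (x ≡ y)
inner a ≟ᵖ inner b = map′ (cong inner) (λ { refl → refl }) (a ≟ b)
inner a ≟ᵖ left k  = no λ ()
inner a ≟ᵖ right k = no λ ()
left j  ≟ᵖ inner b = no λ ()
left j  ≟ᵖ left k  = map′ (cong left) (λ { refl → refl }) (j ≟ k)
left j  ≟ᵖ right k = no λ ()
right j ≟ᵖ inner b = no λ ()
right j ≟ᵖ left k  = no λ ()
right j ≟ᵖ right k = map′ (cong right) (λ { refl → refl }) (j ≟ k)

-- Row a lists the three edge ends at vertex a. The first row is x, the only vertex with two
-- semiedges.
port : Fin 8 → Fin 3 → Port
port = lookup
  ( tri (left (# 0))  (right (# 0)) (inner (# 4))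
  ∷ tri (right (# 1)) (inner (# 2)) (inner (# 6))
  ∷ tri (left (# 1))  (inner (# 1)) (inner (# 7))
  ∷ tri (left (# 2))  (inner (# 5)) (inner (# 6))
  ∷ tri (inner (# 0)) (inner (# 6)) (inner (# 7))
  ∷ tri (right (# 2)) (inner (# 3)) (inner (# 7))
  ∷ tri (inner (# 1)) (inner (# 3)) (inner (# 4))
  ∷ tri (inner (# 2)) (inner (# 4)) (inner (# 5)) ∷ [])

-- The tables were found by exhaustive search.
parts : Scheme → Vec Side 8
parts (into zero)        = R ∷ L ∷ L ∷ L ∷ R ∷ R ∷ L ∷ R ∷ []
parts (into (suc zero))  = R ∷ R ∷ L ∷ L ∷ R ∷ L ∷ R ∷ L ∷ []
parts (outof zero)       = L ∷ R ∷ R ∷ L ∷ L ∷ R ∷ L ∷ R ∷ []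
parts (outof (suc zero)) = L ∷ R ∷ L ∷ R ∷ L ∷ R ∷ R ∷ L ∷ []
parts (spread _)         = L ∷ L ∷ L ∷ L ∷ L ∷ L ∷ L ∷ L ∷ []

-- Entry k of row a is the letter on the edge end `port a k`.
glyphs : Scheme → Vec (Fin 3 → Fin 3) 8
glyphs (into zero) =
  tri α β γ ∷ tri α γ β ∷ tri β γ α ∷ tri β α γ ∷ tri γ α β ∷ tri β α γ ∷ tri β γ α ∷ tri α β γ ∷ []
glyphs (into (suc zero)) =
  tri α β γ ∷ tri β α γ ∷ tri β α γ ∷ tri β γ α ∷ tri γ β α ∷ tri α γ β ∷ tri γ α β ∷ tri γ α β ∷ []
glyphs (outof zero) =
  tri β α γ ∷ tri β γ α ∷ tri α γ β ∷ tri β α γ ∷ tri γ β α ∷ tri β α γ ∷ tri α γ β ∷ tri β α γ ∷ []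
glyphs (outof (suc zero)) =
  tri β α γ ∷ tri β α γ ∷ tri β α γ ∷ tri α γ β ∷ tri γ α β ∷ tri β γ α ∷ tri γ β α ∷ tri γ β α ∷ []
glyphs (spread zero) =
  tri β α γ ∷ tri α β γ ∷ tri α β γ ∷ tri β γ α ∷ tri γ β α ∷ tri α γ β ∷ tri γ α β ∷ tri γ α β ∷ []
glyphs (spread (suc zero)) =
  tri β α γ ∷ tri α γ β ∷ tri β γ α ∷ tri α β γ ∷ tri γ α β ∷ tri α β γ ∷ tri β γ α ∷ tri α β γ ∷ []

-- Of the nine inner edges, `into` and `outof` leave exactly these six inside a part. Under `spread`
-- all nine qualify and six are picked.
poorEdges : Scheme → Vec (Fin 8 × Fin 8) 6
poorEdges (into zero)        = (# 0 , # 4) ∷ (# 1 , # 2) ∷ (# 1 , # 6) ∷ (# 3 , # 6) ∷ (# 4 , # 7) ∷ (# 5 , # 7) ∷ []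
poorEdges (into (suc zero))  = (# 0 , # 4) ∷ (# 1 , # 6) ∷ (# 2 , # 7) ∷ (# 3 , # 5) ∷ (# 4 , # 6) ∷ (# 5 , # 7) ∷ []
poorEdges (outof zero)       = (# 0 , # 4) ∷ (# 1 , # 2) ∷ (# 2 , # 7) ∷ (# 3 , # 6) ∷ (# 4 , # 6) ∷ (# 5 , # 7) ∷ []
poorEdges (outof (suc zero)) = (# 0 , # 4) ∷ (# 1 , # 6) ∷ (# 2 , # 7) ∷ (# 3 , # 5) ∷ (# 3 , # 6) ∷ (# 4 , # 7) ∷ []
poorEdges (spread _)         = (# 0 , # 4) ∷ (# 1 , # 2) ∷ (# 1 , # 6) ∷ (# 2 , # 7) ∷ (# 3 , # 5) ∷ (# 3 , # 6) ∷ []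

part : Scheme → Fin 8 → Side
part s = lookup (parts s)

glyph : Scheme → Fin 8 → Fin 3 → Fin 3
glyph s = lookup (glyphs s)

poorEdge : Scheme → Fin 6 → Fin 8 × Fin 8
poorEdge s = lookup (poorEdges s)

se? : ∀ a b → Dec (SEAdj a b)
se? a b = T? _

_≟²_ : (x y : Fin 8 × Fin 8) → Dec (x ≡ y)
_≟²_ = ≡-dec _≟_ _≟_

glyph-injective : ∀ s a k k′ → glyph s a k ≡ glyph s a k′ → k ≡ k′
glyph-injective = decided (scheme? λ s → all? λ a → all? λ k → all? λ k′ →
  (glyph s a k ≟ glyph s a k′) →-dec (k ≟ k′))

-- Both ends of an inner edge must show one letter, and that letter must be `α` between different
-- parts, because only `α` means the same colour in both.
inner-mates : ∀ a b → SEAdj a b → ∃[ k ] ∃[ k′ ]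
  (port a k ≡ inner b × port b k′ ≡ inner a ×
   ∀ s → glyph s a k ≡ glyph s b k′ × (glyph s a k ≡ α ⊎ part s a ≡ part s b))
inner-mates = decided (all? λ a → all? λ b → se? a b →-dec any? λ k → any? λ k′ →
  (port a k ≟ᵖ inner b) ×-dec (port b k′ ≟ᵖ inner a) ×-dec
  scheme? λ s → (glyph s a k ≟ glyph s b k′) ×-dec ((glyph s a k ≟ α) ⊎-dec (part s a ≟ˢ part s b)))

port-adjacent : ∀ a k b → port a k ≡ inner b → SEAdj a b
port-adjacent = decided (all? λ a → all? λ k → all? λ b → (port a k ≟ᵖ inner b) →-dec se? a b)

port-left : ∀ a k j → port a k ≡ left j → a ≡ leftEnd j
port-left = decided (all? λ a → all? λ k → all? λ j → (port a k ≟ᵖ left j) →-dec (a ≟ leftEnd j))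

port-right : ∀ a k j → port a k ≡ right j → a ≡ rightEnd j
port-right = decided (all? λ a → all? λ k → all? λ j → (port a k ≟ᵖ right j) →-dec (a ≟ rightEnd j))

-- No vertex has two left or two right semiedges, so two ports on the same side may count as
-- clashing whatever their indices; their far ends then need no comparison.
Clash : Port → Port → Set
Clash (inner a) (inner b) = a ≡ b
Clash (left _)  (left _)  = ⊤
Clash (right _) (right _) = ⊤
Clash _         _         = ⊥

clash? : ∀ x y → Dec (Clash x y)
clash? (inner a) (inner b) = a ≟ b
clash? (inner _) (left _)  = no λ ()
clash? (inner _) (right _) = no λ ()
clash? (left _)  (inner _) = no λ ()
clash? (left _)  (left _)  = yes _
clash? (left _)  (right _) = no λ ()
clash? (right _) (inner _) = no λ ()
clash? (right _) (left _)  = no λ ()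
clash? (right _) (right _) = yes _

port-clash : ∀ a k k′ → Clash (port a k) (port a k′) → k ≡ k′
port-clash = decided (all? λ a → all? λ k → all? λ k′ →
  clash? (port a k) (port a k′) →-dec (k ≟ k′))

-- The letters on the semiedges of one side, where `γ` never occurs. `nothing` stands for a right
-- side with all three semiedges coloured `α`.
glyphAt : Maybe (Fin 3) → Fin 3 → Fin 3
glyphAt nothing  k = α
glyphAt (just o) k = if does (k ≟ o) then α else β

left-mate : ∀ j → ∃[ k ] (port (leftEnd j) k ≡ left j ×
  ∀ s → glyph s (leftEnd j) k ≡ glyphAt (just (leftOdd s)) j ×
        (glyph s (leftEnd j) k ≡ α ⊎ part s (leftEnd j) ≡ L))
left-mate = decided (all? λ j → any? λ k → (port (leftEnd j) k ≟ᵖ left j) ×-dec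
  scheme? λ s → (glyph s (leftEnd j) k ≟ glyphAt (just (leftOdd s)) j) ×-dec
    ((glyph s (leftEnd j) k ≟ α) ⊎-dec (part s (leftEnd j) ≟ˢ L)))

right-mate : ∀ j → ∃[ k ] (port (rightEnd j) k ≡ right j ×
  ∀ s → glyph s (rightEnd j) k ≡ glyphAt (rightOdd s) j ×
        (glyph s (rightEnd j) k ≡ α ⊎ part s (rightEnd j) ≡ R))
right-mate = decided (all? λ j → any? λ k → (port (rightEnd j) k ≟ᵖ right j) ×-dec
  scheme? λ s → (glyph s (rightEnd j) k ≟ glyphAt (rightOdd s) j) ×-dec
    ((glyph s (rightEnd j) k ≟ α) ⊎-dec (part s (rightEnd j) ≟ˢ R)))

poorEdge-inner : ∀ s e → let a , b = poorEdge s e in SEAdj a b × part s a ≡ part s b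
poorEdge-inner = decided (scheme? λ s → all? λ e →
  se? (proj₁ (poorEdge s e)) (proj₂ (poorEdge s e)) ×-dec
  (part s (proj₁ (poorEdge s e)) ≟ˢ part s (proj₂ (poorEdge s e))))

poorEdge-distinct : ∀ s e e′ → (poorEdge s e ≡ poorEdge s e′ → e ≡ e′) × poorEdge s e ≢ swap (poorEdge s e′)
poorEdge-distinct = decided (scheme? λ s → all? λ e → all? λ e′ →
  ((poorEdge s e ≟² poorEdge s e′) →-dec (e ≟ e′)) ×-dec
  ¬? (poorEdge s e ≟² swap (poorEdge s e′)))

-- Colours at a junction.

-- This is 2d - k modulo 3: `d` is fixed and the other two positions are exchanged.
reflect : Fin 3 → Fin 3 → Fin 3
reflect = lookup (tri (# 0) (# 2) (# 1) ∷ tri (# 2) (# 1) (# 0) ∷ tri (# 1) (# 0) (# 2) ∷ [])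

reflect-involutive : ∀ d k → reflect d (reflect d k) ≡ k
reflect-involutive = decided (all? λ d → all? λ k → reflect d (reflect d k) ≟ k)

-- A docked odd semiedge is continued by the dock.  Otherwise the dock has colour fwd towards block i-1 and back
-- towards block i, so the plain edges of type A make the third semiedge odd; with type A' the rung, coloured
-- off, exchanges back and fwd and the position is kept.
move : SType → Fin 3 → Fin 3 → Fin 3
move A  d k = reflect d k
move A' d k = k

move-involutive : ∀ t d k → move t d (move t d k) ≡ k
move-involutive A  = reflect-involutive
move-involutive A' d k = refl

-- If all right semiedges of block i-1 are coloured `back`, then at u_i the dock must continue as
-- `fwd`, so it is the odd left semiedge of block i.
oddAfter : SType → Fin 3 → Maybe (Fin 3) → Fin 3
oddAfter t d nothing  = d
oddAfter t d (just k) = move t d k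

-- The letter `α` is the edge e_i for block i and e_{i-1} for block i-1, hence `fwd` and `back` at
-- u_i. The Boolean decides which of the other two names is `β`.
leftGlyphs rightGlyphs : Bool → Fin 3 → Fin 3
leftGlyphs  false = tri fwd back off
leftGlyphs  true  = tri fwd off back
rightGlyphs false = tri back fwd off
rightGlyphs true  = tri back off fwd

leftGlyphs-injective : ∀ c → Injective _≡_ _≡_ (leftGlyphs c)
leftGlyphs-injective false = tri-injective (λ ()) (λ ()) (λ ())
leftGlyphs-injective true  = tri-injective (λ ()) (λ ()) (λ ())

rightGlyphs-injective : ∀ c → Injective _≡_ _≡_ (rightGlyphs c)
rightGlyphs-injective false = tri-injective (λ ()) (λ ()) (λ ())
rightGlyphs-injective true  = tri-injective (λ ()) (λ ()) (λ ())

docked : Fin 3 → Maybe (Fin 3) → Bool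
docked d nothing  = false
docked d (just k) = does (d ≟ k)

-- It makes `β` mean `off` on the left semiedges in two cases: for type A when the plain edges
-- arrive as `off`, and for type A' when they arrive as `back` and the rung is `fwd`.
leftMode : SType → Fin 3 → Maybe (Fin 3) → Bool
leftMode A  d o        = docked d o
leftMode A' d (just _) = false
leftMode A' d nothing  = true

rightLabel leftLabel : SType → Fin 3 → Maybe (Fin 3) → Fin 3 → Fin 3
rightLabel t d o k = rightGlyphs (docked d o) (glyphAt o k)
leftLabel  t d o k = leftGlyphs (leftMode t d o) (glyphAt (just (oddAfter t d o)) k)

rungLabel : Fin 3 → Maybe (Fin 3) → Fin 3
rungLabel d nothing  = fwd
rungLabel d (just k) = if does (d ≟ k) then fwd else off

Distinct : Fin 3 → Fin 3 → Fin 3 → Set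
Distinct x y z = x ≢ y × x ≢ z × y ≢ z

distinct? : ∀ x y z → Dec (Distinct x y z)
distinct? x y z = ¬? (x ≟ y) ×-dec ¬? (x ≟ z) ×-dec ¬? (y ≟ z)

maybe? : ∀ {P : Maybe (Fin 3) → Set} → (∀ o → Dec (P o)) → Dec (∀ o → P o)
maybe? P? = map′ (λ { (f , g) nothing → f ; (f , g) (just k) → g k })
                 (λ f → f nothing , λ k → f (just k))
  (P? nothing ×-dec all? (λ k → P? (just k)))

-- The edge f_i keeps its name `off`, so the two halves of the dock edge must share out `back` and
-- `fwd`.
dock-labels : ∀ t d o → Distinct (rightLabel t d o d) (leftLabel t d o d) off
dock-labels A  = decided (all? λ d → maybe? λ o → distinct? (rightLabel A d o d) (leftLabel A d o d) off)
dock-labels A' = decided (all? λ d → maybe? λ o → distinct? (rightLabel A' d o d) (leftLabel A' d o d) off)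

plain-labels : ∀ {t} → t ≡ A → ∀ d o k → k ≢ d → rightLabel t d o k ≡ leftLabel t d o k
plain-labels refl = decided (all? λ d → maybe? λ o → all? λ k →
  ¬? (k ≟ d) →-dec (rightLabel A d o k ≟ leftLabel A d o k))

rung-labels : ∀ {t} → t ≡ A' → ∀ d o k → k ≢ d →
  Distinct (rightLabel t d o k) (leftLabel t d o k) (rungLabel d o)
rung-labels refl = decided (all? λ d → maybe? λ o → all? λ k →
  ¬? (k ≟ d) →-dec distinct? (rightLabel A' d o k) (leftLabel A' d o k) (rungLabel d o))

unslot : Fin 3 → Fin 2 → Fin 3
unslot = lookup (lookup (# 1 ∷ # 2 ∷ []) ∷ lookup (# 0 ∷ # 2 ∷ []) ∷ lookup (# 0 ∷ # 1 ∷ []) ∷ [])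

unslot-slot : ∀ d k → k ≢ d → unslot d (slot d k) ≡ k
unslot-slot = decided (all? λ d → all? λ k → ¬? (k ≟ d) →-dec (unslot d (slot d k) ≟ k))

slot-unslot : ∀ d x → slot d (unslot d x) ≡ x
slot-unslot = decided (all? λ d → all? λ x → slot d (unslot d x) ≟ x)

unslot≢ : ∀ d x → unslot d x ≢ d
unslot≢ = decided (all? λ d → all? λ x → ¬? (unslot d x ≟ d))

-- A closed walk of odd positions.

module _ (t : SType) (d : Fin 3) (π : Permutation′ 3) where

  arrive : Maybe (Fin 3) → Fin 3
  arrive o = oddAfter t d (map (π ⟨$⟩ʳ_) o)

  arrive-surjective : ∀ k → ∃[ o ] arrive (just o) ≡ k
  arrive-surjective k = π ⟨$⟩ˡ move t d k , trans (cong (move t d) (inverseʳ π)) (move-involutive t d k)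

  -- One step of the walk, from the odd left position of a block to that of the next block.
  Passage : Fin 3 → Fin 3 → Set
  Passage a b = ∃[ s ] (leftOdd s ≡ a × arrive (rightOdd s) ≡ b)

  -- The walk is confined to two states: the semiedge at x and one fixed other left position.
  node : Fin 2 → Bool → Fin 3
  node ν b = if b then suc ν else zero

  -- The odd right position that leads to `k` exists by surjectivity. If it is at x, the block is
  -- crossed by `outof` from the other state, and otherwise by `into` from x.
  predecessor : ∀ ν k → ∃[ b ] Passage (node ν b) k
  predecessor ν k with arrive-surjective k
  ... | zero  , eq = true  , outof ν , refl , eq
  ... | suc o , eq = false , into o , refl , eq

  -- The schemes `into` leave by either right semiedge away from x, so from x they reach every
  -- position except the image `suc ω` of x. The choice of ν keeps both states away from `suc ω`.
  from-zero : arrive (just zero) ≢ zero → ∃[ ν ] ∀ b → Passage zero (node ν b)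
  from-zero 0≢ with arrive (just zero) in eq₀
  ... | zero  = contradiction refl 0≢
  ... | suc ω = opposite ω , λ b → leave (avoid ω b)
    where
    avoid : ∀ ω b → node (opposite ω) b ≢ suc ω
    avoid zero       false ()
    avoid zero       true  ()
    avoid (suc zero) false ()
    avoid (suc zero) true  ()
    leave : ∀ {k} → k ≢ suc ω → Passage zero k
    leave {k} k≢ with arrive-surjective k
    ... | zero  , eq = contradiction (trans (sym eq) eq₀) k≢
    ... | suc o , eq = into o , refl , eq

  -- If the junction moves x, `from-zero` applies. If it fixes x, the dock is away from x, since a
  -- dock at x would force π to fix x. Then ν is taken at the dock: `outof` leads from there to x,
  -- and `spread` leads back to the dock.
  switch : (π ⟨$⟩ʳ zero ≢ zero ⊎ d ≢ zero) → ∃[ ν ] ∃[ b₀ ] ∀ b → Passage (node ν b₀) (node ν b)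
  switch h with arrive (just zero) ≟ zero
  ... | no 0≢  = let ν , pass = from-zero 0≢ in ν , false , pass
  ... | yes 0≡ = stay d refl
    where
    stay : ∀ d′ → d ≡ d′ → ∃[ ν ] ∃[ b₀ ] ∀ b → Passage (node ν b₀) (node ν b)
    stay (suc ν) d≡ = ν , true , λ { false → outof ν , refl , 0≡ ; true → spread ν , refl , d≡ }
    stay zero d≡ = contradiction
      (move-zero t (π ⟨$⟩ʳ zero) (subst (λ z → move t z (π ⟨$⟩ʳ zero) ≡ zero) d≡ 0≡))
      (Data.Sum.[ (λ π≢ → π≢) , contradiction d≡ ]′ h)
      where
      move-zero : ∀ t k → move t zero k ≡ zero → k ≡ zero
      move-zero t k eq = trans (sym (move-involutive t zero k)) (trans (cong (move t zero) eq) (zero-fixed t))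
        where
        zero-fixed : ∀ t → move t zero zero ≡ zero
        zero-fixed A  = refl
        zero-fixed A' = refl

schemes : ∀ {g} (t : Fin g → SType) (p : Fin g → Permutation′ 3) (d : Fin g → Fin 3) →
  (∃[ i ] ((p i ⟨$⟩ʳ zero) ≢ zero ⊎ d i ≢ zero)) →
  Σ (Fin g → Scheme) λ S →
    ∀ i → leftOdd (S i) ≡ arrive (t i) (d i) (p (prev i)) (rightOdd (S (prev i)))
schemes {g} t p d (i₀ , odd) = scheme , λ i →
  subst (λ j → leftOdd (scheme j) ≡ arrive (t j) (d j) (p (prev j)) (rightOdd (scheme (prev i))))
    (next-prev i) (fit (prev i))
  where
  Odd : Fin g → Set
  Odd K = (p (prev (next K)) ⟨$⟩ʳ zero) ≢ zero ⊎ d (next K) ≢ zero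
  -- The junction after block K is governed by the permutation at K but by the dock at K+1, so the
  -- two cases select different blocks.
  locate : (p i₀ ⟨$⟩ʳ zero) ≢ zero ⊎ d i₀ ≢ zero → ∃ Odd
  locate (inj₁ h) = i₀ , inj₁ (subst (λ j → (p j ⟨$⟩ʳ zero) ≢ zero) (sym (prev-next i₀)) h)
  locate (inj₂ h) = prev i₀ , inj₂ (subst (λ j → d j ≢ zero) (sym (next-prev i₀)) h)
  K = proj₁ (locate odd)
  P : Fin g → Fin 3 → Fin 3 → Set
  P i = Passage (t (next i)) (d (next i)) (p (prev (next i)))
  start = switch (t (next K)) (d (next K)) (p (prev (next K))) (proj₂ (locate odd))
  ν = proj₁ start
  b₀ = proj₁ (proj₂ start)
  ⟦_⟧ : Bool → Fin 3
  ⟦ b ⟧ = if b then suc ν else zero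
  -- At K the answer is `b₀` for every `b`, which makes `F K` constant.
  choose : ∀ i → Dec (i ≡ K) → ∀ b → ∃[ a ] P i ⟦ a ⟧ ⟦ b ⟧
  choose i (yes refl) b = b₀ , proj₂ (proj₂ start) b
  choose i (no _)     b = predecessor (t (next i)) (d (next i)) (p (prev (next i))) ν ⟦ b ⟧
  F : Fin g → Bool → Bool
  F i b = proj₁ (choose i (i ≟ K) b)
  F-const : ∀ x y → F K x ≡ F K y
  F-const x y with K ≟ K
  ... | yes refl = refl
  ... | no K≢K   = contradiction refl K≢K
  walk = cyclic-fixpoint F K F-const false
  state = proj₁ walk
  pass : ∀ i → P i ⟦ state i ⟧ ⟦ state (next i) ⟧
  pass i = subst (λ b → P i ⟦ b ⟧ ⟦ state (next i) ⟧) (sym (proj₂ walk i))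
    (proj₂ (choose i (i ≟ K) (state (next i))))
  scheme : Fin g → Scheme
  scheme i = proj₁ (pass i)
  fit : ∀ i → leftOdd (scheme (next i)) ≡ arrive (t (next i)) (d (next i)) (p (prev (next i))) (rightOdd (scheme i))
  fit i = trans (proj₁ (proj₂ (pass (next i)))) (sym (proj₂ (proj₂ (pass i))))

-- Neighbour lists and colour sets of cubic graphs.

HasSize-resp : ∀ {k m} {P Q : Fin k → Set} →
  (∀ c → P c → Q c) → (∀ c → Q c → P c) → HasSize P m → HasSize Q m
HasSize-resp P⇒Q Q⇒P (f , inj , char) =
  f , inj , λ c → (λ q → proj₁ (char c) (Q⇒P c q)) , (λ i → P⇒Q c (proj₂ (char c) i))

record Neighbours {n} (G : Graph n) (v : Fin n) : Set where
  field
    at        : Fin 3 → Fin n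
    adjacent  : ∀ k → Adj G v (at k)
    injective : Injective _≡_ _≡_ at
    complete  : ∀ w → Adj G v w → ∃[ k ] at k ≡ w
open Neighbours

neighbours : ∀ {n} (G : Graph n) → Cubic G → ∀ v → Neighbours G v
neighbours G cubic v with cubic v
... | a , b , c , va , vb , vc , a≢b , a≢c , b≢c , all = record
  { at        = tri a b c
  ; adjacent  = λ { zero → va ; (suc zero) → vb ; (suc (suc zero)) → vc }
  ; injective = tri-injective a≢b a≢c b≢c
  ; complete  = λ w vw → find (all w vw)
  }
  where
  find : ∀ {w} → w ≡ a ⊎ w ≡ b ⊎ w ≡ c → ∃[ k ] tri a b c k ≡ w
  find (inj₁ refl)        = # 0 , refl
  find (inj₂ (inj₁ refl)) = # 1 , refl
  find (inj₂ (inj₂ refl)) = # 2 , refl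

remaining : ∀ x y → x ≢ y → ∃[ z ] Distinct x y z
remaining = decided (all? λ x → all? λ y → ¬? (x ≟ y) →-dec any? λ z → distinct? x y z)

-- Used to order the neighbours of u_i so that `back`, `fwd` and `off` name u_{i-1}, u_{i+1} and
-- v_i.
neighbours-from : ∀ {n} {G : Graph n} {v x y} → Neighbours G v → Adj G v x → Adj G v y → x ≢ y →
  Σ (Neighbours G v) λ N → at N back ≡ x × at N fwd ≡ y
neighbours-from {x = x} {y} N vx vy x≢y with complete N x vx | complete N y vy
... | a , refl | b , refl with remaining a b (x≢y ∘ cong (at N))
... | c , a≢b , a≢c , b≢c = record
  { at        = at N ∘ tri a b c
  ; adjacent  = adjacent N ∘ tri a b c
  ; injective = tri-injective a≢b a≢c b≢c ∘ injective N
  ; complete  = λ w vw →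
      let k , eq = complete N w vw
          l , eq′ = tri-surjective a b c a≢b a≢c b≢c k
      in l , trans (cong (at N) eq′) eq
  } , refl , refl

record Palette {V : Set} {Adj : V → V → Set} {k} (σ : EdgeColoring Adj k) (v : V) (f : Fin 3 → Fin k) : Set where
  field
    distinct  : Injective _≡_ _≡_ f
    present   : ∀ i → ColorsAt σ v (f i)
    exhausted : ∀ c → ColorsAt σ v c → ∃[ i ] f i ≡ c
open Palette

module _ {V : Set} {Adj : V → V → Set} {k} {σ : EdgeColoring Adj k} {v : V} where

  palette-permute : ∀ {f} → Palette σ v f → (h : Fin 3 → Fin 3) → Injective _≡_ _≡_ h → Palette σ v (f ∘ h)
  palette-permute {f} P h inj = record
    { distinct  = inj ∘ distinct P
    ; present   = present P ∘ h
    ; exhausted = λ c vc →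
        let i , eq = exhausted P c vc
            j , eq′ = injective⇒surjective h inj i
        in j , trans (cong f eq′) eq
    }

neighbours-palette : ∀ {n k} {G : Graph n} (σ : EdgeColoring (Adj G) k) {v} (N : Neighbours G v) →
  Palette σ v (λ i → col σ v (at N i))
neighbours-palette σ {v} N = record
  { distinct  = dist _ _
  ; present   = λ i → at N i , adjacent N i , refl
  ; exhausted = λ { c (w , vw , refl) → let i , eq = complete N w vw in i , cong (col σ v) eq }
  }
  where
  dist : ∀ i j → col σ v (at N i) ≡ col σ v (at N j) → i ≡ j
  dist i j eq with i ≟ j
  ... | yes i≡j = i≡j
  ... | no  i≢j = contradiction eq (proper σ (adjacent N i) (adjacent N j) (i≢j ∘ injective N))

-- A vertex `ext i h s` stores a proof `h`, so deciding equality of vertices requires such proofs to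
-- agree.
uip : ∀ {X : Set} {x y : X} (p q : x ≡ y) → p ≡ q
uip refl refl = refl

-- Proper colourings from three labelled ports at each vertex.

module PortColoring {V : Set} {Adj : V → V → Set} {k : ℕ} (_≟ᵛ_ : (x y : V) → Dec (x ≡ y))
  (nbr : V → Fin 3 → V) (lab : V → Fin 3 → Fin (suc k))
  (nbr-injective : ∀ x i j → nbr x i ≡ nbr x j → i ≡ j)
  (lab-injective : ∀ x i j → lab x i ≡ lab x j → i ≡ j)
  (mates : ∀ {x y} → Adj x y → ∃[ i ] ∃[ j ] (nbr x i ≡ y × nbr y j ≡ x × lab x i ≡ lab y j))
  where

  colour : V → V → Fin (suc k)
  colour x y with any? (λ i → nbr x i ≟ᵛ y)
  ... | yes (i , _) = lab x i
  -- An arbitrary colour for pairs not joined by a port.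
  ... | no _        = zero

  colour-nbr : ∀ x i {y} → nbr x i ≡ y → colour x y ≡ lab x i
  colour-nbr x i {y} eq with any? (λ i → nbr x i ≟ᵛ y)
  ... | yes (j , eq′) = cong (lab x) (nbr-injective x j i (trans eq′ (sym eq)))
  ... | no none       = contradiction (i , eq) none

  coloring : EdgeColoring Adj (suc k)
  coloring = record
    { col     = colour
    ; col-sym = λ {x} {y} xy → let i , j , eq , eq′ , lab≡ = mates xy in
        trans (colour-nbr x i eq) (trans lab≡ (sym (colour-nbr y j eq′)))
    ; proper  = λ {x} xy xz y≢z same →
        let i , _ , eq  , _ = mates xy
            j , _ , eq′ , _ = mates xz
            i≡j = lab-injective x i j (trans (sym (colour-nbr x i eq)) (trans same (colour-nbr x j eq′)))
        in y≢z (trans (sym eq) (trans (cong (nbr x) i≡j) eq′))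
    }

-- Ports and labels for the superposition.

module Build {n : ℕ} (G : Graph n) (cubic : Cubic G) (σ : EdgeColoring (Adj G) 5)
  {g : ℕ} (u : Fin g → Fin n) (cyc : IsCycle G g u)
  (ty : Fin g → SType) (p : Fin g → Permutation′ 3) (d : Fin g → Fin 3)
  (S : Fin g → Scheme)
  (fit : ∀ i → leftOdd (S i) ≡ oddAfter (ty i) (d i) (map (p (prev i) ⟨$⟩ʳ_) (rightOdd (S (prev i)))))
  where

  open Superposition G g u ty p d

  3≤g : 3 ≤ g
  3≤g = proj₁ cyc

  u-injective : Injective _≡_ _≡_ u
  u-injective = proj₁ (proj₂ cyc)

  u-next : ∀ i → Adj G (u i) (u (next i))
  u-next = proj₂ (proj₂ cyc)

  u-prev : ∀ i → Adj G (u i) (u (prev i))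
  u-prev i = Adj-sym G (subst (λ j → Adj G (u (prev i)) (u j)) (next-prev i) (u-next (prev i)))

  old-injective : ∀ {a b} → old a ≡ old b → a ≡ b
  old-injective refl = refl

  blk-injective : ∀ {i j a b} → blk i a ≡ blk j b → i ≡ j × a ≡ b
  blk-injective refl = refl , refl

  ext-injective : ∀ {i j h h′ s s′} → ext i h s ≡ ext j h′ s′ → i ≡ j
  ext-injective refl = refl

  _≟ᵛ_ : (x y : V) → Dec (x ≡ y)
  old a ≟ᵛ old b = map′ (cong old) (λ { refl → refl }) (a ≟ b)
  old _ ≟ᵛ blk _ _ = no λ ()
  old _ ≟ᵛ ext _ _ _ = no λ ()
  blk _ _ ≟ᵛ old _ = no λ ()
  blk i a ≟ᵛ blk j b with i ≟ j | a ≟ b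
  ... | yes refl | yes refl = yes refl
  ... | no i≢j   | _        = no λ { refl → i≢j refl }
  ... | _        | no a≢b   = no λ { refl → a≢b refl }
  blk _ _ ≟ᵛ ext _ _ _ = no λ ()
  ext _ _ _ ≟ᵛ old _ = no λ ()
  ext _ _ _ ≟ᵛ blk _ _ = no λ ()
  ext i h s ≟ᵛ ext j h′ s′ with i ≟ j | s ≟ s′
  ... | yes refl | yes refl = yes (cong (λ z → ext i z s) (uip h h′))
  ... | no i≢j   | _        = no λ { refl → i≢j refl }
  ... | _        | no s≢s′  = no λ { refl → s≢s′ refl }

  cycleNbhd : ∀ i → Σ (Neighbours G (u i)) λ N → at N back ≡ u (prev i) × at N fwd ≡ u (next i)
  cycleNbhd i = neighbours-from (neighbours G cubic (u i)) (u-prev i) (u-next i)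
    (λ eq → next≢prev 3≤g i (sym (u-injective eq)))

  N : ∀ i → Neighbours G (u i)
  N i = proj₁ (cycleNbhd i)

  -- The colours of e_{i-1}, e_i and f_i under σ.
  C : Fin g → Fin 3 → Fin 5
  C i l = col σ (u i) (at (N i) l)

  C-cycle : ∀ i → C i fwd ≡ C (next i) back
  C-cycle i = begin
    C i fwd                              ≡⟨ cong (col σ (u i)) (proj₂ (proj₂ (cycleNbhd i))) ⟩
    col σ (u i) (u (next i))             ≡⟨ col-sym σ (u-next i) ⟩
    col σ (u (next i)) (u i)             ≡⟨ cong (λ j → col σ (u (next i)) (u j)) (prev-next i) ⟨
    col σ (u (next i)) (u (prev (next i))) ≡⟨ cong (col σ (u (next i))) (proj₁ (proj₂ (cycleNbhd (next i)))) ⟨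
    C (next i) back                      ∎
    where open ≡-Reasoning

  -- The vertex v_i may lie on the cycle, but it differs from u_{i-1} and u_{i+1}, so f_i is at most
  -- a chord.
  off-chord : ∀ i → ¬ CycleEdge (u i) (at (N i) off)
  off-chord i (j , inj₁ (ui≡uj , eq)) with u-injective ui≡uj
  ... | refl with injective (N i) {off} {fwd} (trans eq (sym (proj₂ (proj₂ (cycleNbhd i)))))
  ... | ()
  off-chord i (j , inj₂ (eq , ui≡un)) with u-injective ui≡un
  ... | refl with injective (N i) {off} {back}
                    (trans eq (trans (cong u (sym (prev-next j))) (sym (proj₁ (proj₂ (cycleNbhd i))))))
  ... | ()

  noncycle⇒off : ∀ i {w} → Adj G (u i) w → ¬ CycleEdge (u i) w → at (N i) off ≡ w
  noncycle⇒off i {w} uw ¬cycle with complete (N i) w uw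
  ... | back , eq = contradiction
    (prev i , inj₂ (trans (sym eq) (proj₁ (proj₂ (cycleNbhd i))) , cong u (sym (next-prev i)))) ¬cycle
  ... | fwd  , eq = contradiction (i , inj₁ (refl , trans (sym eq) (proj₂ (proj₂ (cycleNbhd i))))) ¬cycle
  ... | off  , eq = eq

  OnCycle : Fin n → Set
  OnCycle v = ∃[ i ] u i ≡ v

  onCycle? : ∀ v → Dec (OnCycle v)
  onCycle? v = any? λ i → u i ≟ v

  incoming : Fin g → Maybe (Fin 3)
  incoming i = map (p (prev i) ⟨$⟩ʳ_) (rightOdd (S (prev i)))

  rightAt leftAt : Fin g → Fin 3 → Fin 3
  rightAt i = rightLabel (ty i) (d i) (incoming i)
  leftAt i = leftLabel (ty i) (d i) (incoming i)

  leftMode′ rightMode′ : Fin g → Bool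
  leftMode′ i = leftMode (ty i) (d i) (incoming i)
  rightMode′ i = docked (d i) (incoming i)

  rung : Fin g → Fin 3
  rung i = rungLabel (d i) (incoming i)

  key : Fin g → Fin 3 → Fin 3
  key i j = p (prev i) ⟨$⟩ʳ j

  source : Fin g → Fin 3 → Fin 3
  source i k = p (prev i) ⟨$⟩ˡ k

  key-source : ∀ i k → key i (source i k) ≡ k
  key-source i k = inverseʳ (p (prev i))

  source-key : ∀ i j → source i (key i j) ≡ j
  source-key i j = inverseˡ (p (prev i))

  blkL blkR : Fin g → Fin 3 → V
  blkR i j = blk (prev i) (rightEnd j)
  blkL i k = blk i (leftEnd k)

  -- The type comes with an equation, so that the case `A'` has the proof that `ext` stores.
  bridge : ∀ i → Fin 3 → V → (t : SType) → ty i ≡ t → V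
  bridge i k far A  _ = far
  bridge i k far A' h = ext i h (slot (d i) k)

  cross : ∀ i k → Dec (k ≡ d i) → V → V
  cross i k (yes _) far = old (u i)
  cross i k (no _)  far = bridge i k far (ty i) refl

  toLeft toRight : Fin g → Fin 3 → V
  toLeft  i k = cross i k (k ≟ d i) (blkR i (source i k))
  toRight i j = cross i (key i j) (key i j ≟ d i) (blkL i (key i j))

  via : Fin g → Port → V
  via i (inner b) = blk i b
  via i (left k)  = toLeft i k
  via i (right j) = toRight (next i) j

  oldNbr : ∀ v → Dec (OnCycle v) → Fin 3 → V
  oldNbr v (yes (i , _)) = tri (blkR i (source i (d i))) (blkL i (d i)) (old (at (N i) off))
  oldNbr v (no _)        = old ∘ at (neighbours G cubic v)

  nbr : V → Fin 3 → V
  nbr (old v)     = oldNbr v (onCycle? v)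
  nbr (blk i a) k = via i (port a k)
  nbr (ext i h s) = tri (blkR i (source i (unslot (d i) s))) (blkL i (unslot (d i) s)) (ext i h (opposite s))

  -- Letters are read as colours at u_i in the left part and at u_{i+1} in the right part.
  shade : Fin g → Side → Fin 3 → Fin 5
  shade i L x = C i (leftGlyphs (leftMode′ i) x)
  shade i R x = C (next i) (rightGlyphs (rightMode′ (next i)) x)

  oldLab : ∀ v → Dec (OnCycle v) → Fin 3 → Fin 5
  oldLab v (yes (i , _)) = C i ∘ tri (rightAt i (d i)) (leftAt i (d i)) off
  oldLab v (no _)        = col σ v ∘ at (neighbours G cubic v)

  lab : V → Fin 3 → Fin 5
  lab (old v)     = oldLab v (onCycle? v)
  lab (blk i a)   = shade i (part (S i) a) ∘ glyph (S i) a
  lab (ext i h s) = C i ∘ tri (rightAt i (unslot (d i) s)) (leftAt i (unslot (d i) s)) (rung i)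

  corner : Fin g → Side → Fin n
  corner i L = u i
  corner i R = u (next i)

  ψ : V → Fin n
  ψ (old v)     = v
  ψ (blk i a)   = corner i (part (S i) a)
  ψ (ext i _ _) = u i

  C-palette : ∀ i → Palette σ (u i) (C i)
  C-palette i = neighbours-palette σ (N i)

  C-tri : ∀ i {x y z} → Distinct x y z → Palette σ (u i) (C i ∘ tri x y z)
  C-tri i (xy , xz , yz) = palette-permute (C-palette i) _ (tri-injective xy xz yz)

  -- In every case the labels are the three colours at `ψ x` in permuted order: the junction names
  -- and the letters at a block vertex are distinct.
  lab-palette : ∀ x → Palette σ (ψ x) (lab x)
  lab-palette (old v) with onCycle? v
  ... | yes (i , refl) = C-tri i (dock-labels (ty i) (d i) (incoming i))
  ... | no _ = neighbours-palette σ (neighbours G cubic v)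
  lab-palette (blk i a) with part (S i) a
  ... | L = palette-permute (C-palette i) _ (glyph-injective (S i) a _ _ ∘ leftGlyphs-injective (leftMode′ i))
  ... | R = palette-permute (C-palette (next i)) _ (glyph-injective (S i) a _ _ ∘ rightGlyphs-injective (rightMode′ (next i)))
  lab-palette (ext i h s) = C-tri i (rung-labels h (d i) (incoming i) _ (unslot≢ (d i) s))

  lab-injective : ∀ x i j → lab x i ≡ lab x j → i ≡ j
  lab-injective x _ _ = distinct (lab-palette x)

  -- The three neighbours of a vertex are distinct.

  cross-dock : ∀ {i k far} (k? : Dec (k ≡ d i)) → k ≡ d i → cross i k k? far ≡ old (u i)
  cross-dock (yes _)  _   = refl
  cross-dock (no k≢d) k≡d = contradiction k≡d k≢d

  bridge-plain : ∀ {i k far} t (h : ty i ≡ t) → ty i ≡ A → bridge i k far t h ≡ far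
  bridge-plain A  _ _ = refl
  bridge-plain A' h e with trans (sym e) h
  ... | ()

  bridge-ext : ∀ {i k far} t (h : ty i ≡ t) (e : ty i ≡ A') → bridge i k far t h ≡ ext i e (slot (d i) k)
  bridge-ext A  h e with trans (sym e) h
  ... | ()
  bridge-ext A' h e = cong (λ z → ext _ z _) (uip h e)

  cross-plain : ∀ {i k far} (k? : Dec (k ≡ d i)) → k ≢ d i → ty i ≡ A → cross i k k? far ≡ far
  cross-plain (yes k≡d) k≢d _ = contradiction k≡d k≢d
  cross-plain {i} (no _) _ e = bridge-plain (ty i) refl e

  cross-ext : ∀ {i k far} (k? : Dec (k ≡ d i)) → k ≢ d i → (e : ty i ≡ A') →
    cross i k k? far ≡ ext i e (slot (d i) k)
  cross-ext (yes k≡d) k≢d _ = contradiction k≡d k≢d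
  cross-ext {i} (no _) _ e = bridge-ext (ty i) refl e

  -- The possible values of `cross` with position and type forgotten, which is enough to tell
  -- neighbours apart.
  data Beyond (i : Fin g) : V → V → Set where
    dock  : ∀ {far} → Beyond i far (old (u i))
    plain : ∀ {far} → Beyond i far far
    extra : ∀ {far h s} → Beyond i far (ext i h s)

  beyond : ∀ i k k? far → Beyond i far (cross i k k? far)
  beyond i k (yes _) far = dock
  beyond i k (no _)  far = aux (ty i) refl
    where
    aux : ∀ t h → Beyond i far (bridge i k far t h)
    aux A  h = plain
    aux A' h = extra

  beyond-left≢inner : ∀ {i j a x b} → j ≢ i → Beyond i (blk j a) x → x ≢ blk i b
  beyond-left≢inner j≢i plain refl = j≢i refl

  beyond-right≢inner : ∀ {i i′ a x b} → i′ ≢ i → Beyond i′ (blk i′ a) x → x ≢ blk i b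
  beyond-right≢inner i′≢i plain refl = i′≢i refl

  -- Cycle length at least 3 keeps apart the two junctions of a block and the two blocks next to it.
  beyond-left≢right : ∀ {i a b x y} →
    Beyond i (blk (prev i) a) x → Beyond (next i) (blk (next i) b) y → x ≢ y
  beyond-left≢right {i} {a} {b} {x} {y} l r x≡y = go l r refl refl x≡y
    where
    go : ∀ {f f′ x y} → Beyond i f x → Beyond (next i) f′ y →
      f ≡ blk (prev i) a → f′ ≡ blk (next i) b → x ≢ y
    go dock  dock  _    _    eq   = next≢ 3≤g i (sym (u-injective (old-injective eq)))
    go dock  plain _    refl ()
    go plain dock  refl _    ()
    go plain plain refl refl eq   = next≢prev 3≤g i (sym (proj₁ (blk-injective eq)))
    go plain extra refl _    ()
    go extra plain _    refl ()
    go extra extra _    _    eq   = next≢ 3≤g i (sym (ext-injective eq))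

  left-beyond : ∀ i k → Beyond i (blk (prev i) (rightEnd (source i k))) (toLeft i k)
  left-beyond i k = beyond i k (k ≟ d i) _

  right-beyond : ∀ i j → Beyond i (blk i (leftEnd (key i j))) (toRight i j)
  right-beyond i j = beyond i (key i j) (key i j ≟ d i) _

  via-clash : ∀ i x y → via i x ≡ via i y → Clash x y
  via-clash i (inner a) (inner b) refl = refl
  via-clash i (inner a) (left k)  eq = beyond-left≢inner (prev≢ 3≤g i) (left-beyond i k) (sym eq)
  via-clash i (inner a) (right j) eq = beyond-right≢inner (next≢ 3≤g i) (right-beyond (next i) j) (sym eq)
  via-clash i (left k)  (inner b) eq = beyond-left≢inner (prev≢ 3≤g i) (left-beyond i k) eq
  via-clash i (left _)  (left _)  eq = _
  via-clash i (left k)  (right j) eq = beyond-left≢right (left-beyond i k) (right-beyond (next i) j) eq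
  via-clash i (right j) (inner b) eq = beyond-right≢inner (next≢ 3≤g i) (right-beyond (next i) j) eq
  via-clash i (right j) (left k)  eq = beyond-left≢right (left-beyond i k) (right-beyond (next i) j) (sym eq)
  via-clash i (right _) (right _) eq = _

  nbr-injective : ∀ x i j → nbr x i ≡ nbr x j → i ≡ j
  nbr-injective (old v) _ _ with onCycle? v
  ... | yes (i , refl) = tri-injective (λ { eq → prev≢ 3≤g i (proj₁ (blk-injective eq)) }) (λ ()) (λ ())
  ... | no _ = λ eq → injective (neighbours G cubic v) (old-injective eq)
  nbr-injective (blk i a) k k′ eq = port-clash a k k′ (via-clash i (port a k) (port a k′) eq)
  nbr-injective (ext i h s) _ _ = tri-injective (λ { eq → prev≢ 3≤g i (proj₁ (blk-injective eq)) }) (λ ()) (λ ())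

  -- Junction edges indexed by the left semiedge `k`, and adjacency of ports.

  module _ (i : Fin g) (k : Fin 3) where

    private
      unkey : (P : Fin 3 → Set) → P (key i (source i k)) → P k
      unkey P = subst P (key-source i k)
      key≢ : k ≢ d i → key i (source i k) ≢ d i
      key≢ k≢d eq = k≢d (trans (sym (key-source i k)) eq)

    edge-dockL : k ≡ d i → E (blkR i (source i k)) (old (u i))
    edge-dockL k≡d = dockL i (source i k) (trans (key-source i k) k≡d)

    edge-dockR : k ≡ d i → E (old (u i)) (blkL i k)
    edge-dockR k≡d = unkey (λ z → E (old (u i)) (blkL i z)) (dockR i (source i k) (trans (key-source i k) k≡d))

    edge-plain : ty i ≡ A → k ≢ d i → E (blkR i (source i k)) (blkL i k)
    edge-plain h k≢d = unkey (λ z → E (blkR i (source i k)) (blkL i z)) (plainE i (source i k) h (key≢ k≢d))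

    edge-subL : (h : ty i ≡ A') → k ≢ d i → E (blkR i (source i k)) (ext i h (slot (d i) k))
    edge-subL h k≢d =
      unkey (λ z → E (blkR i (source i k)) (ext i h (slot (d i) z))) (subL i (source i k) h (key≢ k≢d))

    edge-subR : (h : ty i ≡ A') → k ≢ d i → E (ext i h (slot (d i) k)) (blkL i k)
    edge-subR h k≢d =
      unkey (λ z → E (ext i h (slot (d i) z)) (blkL i z)) (subR i (source i k) h (key≢ k≢d))

    adjacent-left : Adj~ (blkL i k) (toLeft i k)
    adjacent-left with k ≟ d i
    ... | yes k≡d = inj₂ (edge-dockR k≡d)
    ... | no k≢d  = aux (ty i) refl
      where
      aux : ∀ t (h : ty i ≡ t) → Adj~ (blkL i k) (bridge i k (blkR i (source i k)) t h)
      aux A  h = inj₂ (edge-plain h k≢d)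
      aux A' h = inj₂ (edge-subR h k≢d)

    adjacent-right : Adj~ (blkR i (source i k)) (cross i k (k ≟ d i) (blkL i k))
    adjacent-right with k ≟ d i
    ... | yes k≡d = inj₁ (edge-dockL k≡d)
    ... | no k≢d  = aux (ty i) refl
      where
      aux : ∀ t (h : ty i ≡ t) → Adj~ (blkR i (source i k)) (bridge i k (blkL i k) t h)
      aux A  h = inj₁ (edge-plain h k≢d)
      aux A' h = inj₁ (edge-subL h k≢d)

  -- Ensures that every label at x is the colour of an actual edge, so no colour at `ψ x` is missing
  -- at x.
  nbr-adjacent : ∀ x k → Adj~ x (nbr x k)
  nbr-adjacent (old v) k with onCycle? v
  nbr-adjacent (old _) zero             | yes (i , refl) = inj₂ (edge-dockL i (d i) refl)
  nbr-adjacent (old _) (suc zero)       | yes (i , refl) = inj₁ (edge-dockR i (d i) refl)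
  nbr-adjacent (old _) (suc (suc zero)) | yes (i , refl) =
    inj₁ (oldE (adjacent (N i) off) (off-chord i))
  nbr-adjacent (old v) k | no v∉C = inj₁ (oldE (adjacent (neighbours G cubic v) k)
    λ { (i , inj₁ (v≡u , _)) → v∉C (i , sym v≡u) ; (i , inj₂ (_ , v≡u)) → v∉C (next i , sym v≡u) })
  nbr-adjacent (blk i a) k with port a k in eq
  ... | inner b = inj₁ (innerE (port-adjacent a k b eq))
  ... | left j rewrite port-left a k j eq = adjacent-left i j
  ... | right j rewrite port-right a k j eq =
    subst₂ (λ i′ j′ → Adj~ (blk i′ (rightEnd j′)) (toRight (next i) j)) (prev-next i) (source-key (next i) j)
      (adjacent-right (next i) (key (next i) j))
  nbr-adjacent (ext i h s) zero = inj₂ (subst (λ z → E (blkR i (source i (unslot (d i) s))) (ext i h z))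
    (slot-unslot (d i) s) (edge-subL i (unslot (d i) s) h (unslot≢ (d i) s)))
  nbr-adjacent (ext i h s) (suc zero) = inj₁ (subst (λ z → E (ext i h z) (blkL i (unslot (d i) s)))
    (slot-unslot (d i) s) (edge-subR i (unslot (d i) s) h (unslot≢ (d i) s)))
  nbr-adjacent (ext i h zero)       (suc (suc zero)) = inj₁ (extE i h)
  nbr-adjacent (ext i h (suc zero)) (suc (suc zero)) = inj₂ (extE i h)

  -- Labels agree at the two ends of every edge.

  Mates : V → V → Set
  Mates x y = ∃[ i ] ∃[ j ] (nbr x i ≡ y × nbr y j ≡ x × lab x i ≡ lab y j)

  glyphAt-map : ∀ (π : Permutation′ 3) o j → glyphAt (map (π ⟨$⟩ʳ_) o) (π ⟨$⟩ʳ j) ≡ glyphAt o j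
  glyphAt-map π nothing  j = refl
  glyphAt-map π (just o) j with j ≟ o | π ⟨$⟩ʳ j ≟ π ⟨$⟩ʳ o
  ... | yes _   | yes _  = refl
  ... | yes j≡o | no neq = contradiction (cong (π ⟨$⟩ʳ_) j≡o) neq
  ... | no j≢o  | yes eq = contradiction
    (trans (sym (inverseˡ π)) (trans (cong (π ⟨$⟩ˡ_) eq) (inverseˡ π))) j≢o
  ... | no _    | no _   = refl

  leftGlyphs-α : ∀ c → leftGlyphs c α ≡ fwd
  leftGlyphs-α false = refl
  leftGlyphs-α true  = refl

  rightGlyphs-α : ∀ c → rightGlyphs c α ≡ back
  rightGlyphs-α false = refl
  rightGlyphs-α true  = refl

  shade-α : ∀ i → shade i L α ≡ shade i R α
  shade-α i = trans (cong (C i) (leftGlyphs-α (leftMode′ i)))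
    (trans (C-cycle i) (cong (C (next i)) (sym (rightGlyphs-α (rightMode′ (next i))))))

  shade-agree : ∀ i {x s s′} → x ≡ α ⊎ s ≡ s′ → shade i s x ≡ shade i s′ x
  shade-agree i (inj₂ refl) = refl
  shade-agree i {s = L} {L} (inj₁ refl) = refl
  shade-agree i {s = L} {R} (inj₁ refl) = shade-α i
  shade-agree i {s = R} {L} (inj₁ refl) = sym (shade-α i)
  shade-agree i {s = R} {R} (inj₁ refl) = refl

  leftAt-glyph : ∀ i k → leftGlyphs (leftMode′ i) (glyphAt (just (leftOdd (S i))) k) ≡ leftAt i k
  leftAt-glyph i k = cong (λ o → leftGlyphs (leftMode′ i) (glyphAt (just o) k)) (fit i)

  rightAt-glyph : ∀ i j → rightGlyphs (rightMode′ i) (glyphAt (rightOdd (S (prev i))) j) ≡ rightAt i (key i j)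
  rightAt-glyph i j = cong (rightGlyphs (rightMode′ i)) (sym (glyphAt-map (p (prev i)) (rightOdd (S (prev i))) j))

  -- The last component serves normality: an end outside the part of u_i carries `α`, which is `fwd`
  -- at u_i.
  left-end : ∀ i k → ∃[ q ] (nbr (blkL i k) q ≡ toLeft i k × lab (blkL i k) q ≡ C i (leftAt i k) ×
                             (leftAt i k ≡ fwd ⊎ ψ (blkL i k) ≡ u i))
  left-end i k with left-mate k
  ... | q , port≡ , mate with mate (S i)
  ... | glyph≡ , odd = q , cong (via i) port≡ ,
    trans (shade-agree i odd)
      (trans (cong (shade i L) glyph≡) (cong (C i) (leftAt-glyph i k))) ,
    Data.Sum.map
      (λ g≡α → trans (sym (leftAt-glyph i k)) (trans (cong (leftGlyphs (leftMode′ i)) (trans (sym glyph≡) g≡α)) (leftGlyphs-α (leftMode′ i))))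
      (cong (corner i)) odd

  right-end : ∀ i j → ∃[ q ] (nbr (blkR i j) q ≡ toRight i j × lab (blkR i j) q ≡ C i (rightAt i (key i j)) ×
                              (rightAt i (key i j) ≡ back ⊎ ψ (blkR i j) ≡ u i))
  right-end i j with right-mate j
  ... | q , port≡ , mate with mate (S (prev i))
  ... | glyph≡ , odd = q , trans (cong (via (prev i)) port≡) (cong (λ i → toRight i j) (next-prev i)) ,
    trans (shade-agree (prev i) odd)
      (trans (cong (shade (prev i) R) glyph≡)
        (trans (cong (λ m → C m (rightGlyphs (rightMode′ m) (glyphAt (rightOdd (S (prev i))) j))) (next-prev i)) (cong (C i) (rightAt-glyph i j)))) ,
    Data.Sum.map
      (λ g≡α → trans (sym (rightAt-glyph i j)) (trans (cong (rightGlyphs (rightMode′ i)) (trans (sym glyph≡) g≡α)) (rightGlyphs-α (rightMode′ i))))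
      (λ s≡R → trans (cong (corner (prev i)) s≡R) (cong u (next-prev i))) odd

  nbr-u : ∀ i → nbr (old (u i)) ≗ tri (blkR i (source i (d i))) (blkL i (d i)) (old (at (N i) off))
  nbr-u i k with onCycle? (u i)
  ... | no ∉C = contradiction (i , refl) ∉C
  ... | yes (j , uj≡ui) with u-injective uj≡ui
  ... | refl = refl

  lab-u : ∀ i → lab (old (u i)) ≗ C i ∘ tri (rightAt i (d i)) (leftAt i (d i)) off
  lab-u i k with onCycle? (u i)
  ... | no ∉C = contradiction (i , refl) ∉C
  ... | yes (j , uj≡ui) with u-injective uj≡ui
  ... | refl = refl

  old-end : ∀ {a b} → Adj G a b → ¬ CycleEdge a b → ∃[ k ] (nbr (old a) k ≡ old b × lab (old a) k ≡ col σ a b)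
  old-end {a} {b} ab ¬cycle with onCycle? a
  ... | yes (i , refl) = let eq = noncycle⇒off i ab ¬cycle in # 2 , cong old eq , cong (col σ (u i)) eq
  ... | no _ = let k , eq = complete (neighbours G cubic a) b ab in k , cong old eq , cong (col σ a) eq

  cycleEdge-sym : ∀ {a b} → CycleEdge a b → CycleEdge b a
  cycleEdge-sym (i , inj₁ e) = i , inj₂ e
  cycleEdge-sym (i , inj₂ e) = i , inj₁ e

  edge-mates : ∀ {x y} → E x y → Mates x y
  edge-mates (oldE {a} {b} ab ¬cycle) =
    let k , nbr≡ , lab≡ = old-end ab ¬cycle
        l , nbr≡′ , lab≡′ = old-end (Adj-sym G ab) (¬cycle ∘ cycleEdge-sym)
    in k , l , nbr≡ , nbr≡′ , trans lab≡ (trans (col-sym σ ab) (sym lab≡′))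
  edge-mates (innerE {i} {a} {b} ab) =
    let k , l , port≡ , port≡′ , mate = inner-mates a b ab
        glyph≡ , agree = mate (S i)
    in k , l , cong (via i) port≡ , cong (via i) port≡′ ,
       trans (shade-agree i agree) (cong (shade i (part (S i) b)) glyph≡)
  edge-mates (dockL i j eq) =
    let q , nbr≡ , lab≡ , _ = right-end i j
    in q , # 0 , trans nbr≡ (cross-dock (key i j ≟ d i) eq) ,
       trans (nbr-u i (# 0)) (cong (blkR i) (trans (cong (source i) (sym eq)) (source-key i j))) ,
       trans lab≡ (trans (cong (C i ∘ rightAt i) eq) (sym (lab-u i (# 0))))
  edge-mates (dockR i j eq) =
    let q , nbr≡ , lab≡ , _ = left-end i (key i j)
    in # 1 , q , trans (nbr-u i (# 1)) (cong (blkL i) (sym eq)) ,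
       trans nbr≡ (cross-dock (key i j ≟ d i) eq) ,
       trans (lab-u i (# 1)) (trans (cong (C i ∘ leftAt i) (sym eq)) (sym lab≡))
  edge-mates (plainE i j h k≢d) =
    let q , nbr≡ , lab≡ , _ = right-end i j
        r , nbr≡′ , lab≡′ , _ = left-end i (key i j)
    in q , r , trans nbr≡ (cross-plain (key i j ≟ d i) k≢d h) ,
       trans nbr≡′ (trans (cross-plain (key i j ≟ d i) k≢d h) (cong (blkR i) (source-key i j))) ,
       trans lab≡ (trans (cong (C i) (plain-labels h (d i) (incoming i) (key i j) k≢d)) (sym lab≡′))
  edge-mates (subL i j h k≢d) =
    let q , nbr≡ , lab≡ , _ = right-end i j
        un = unslot-slot (d i) (key i j) k≢d
    in q , # 0 , trans nbr≡ (cross-ext (key i j ≟ d i) k≢d h) ,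
       cong (blkR i) (trans (cong (source i) un) (source-key i j)) ,
       trans lab≡ (cong (C i ∘ rightAt i) (sym un))
  edge-mates (subR i j h k≢d) =
    let q , nbr≡ , lab≡ , _ = left-end i (key i j)
        un = unslot-slot (d i) (key i j) k≢d
    in # 1 , q , cong (blkL i) un , trans nbr≡ (cross-ext (key i j ≟ d i) k≢d h) ,
       trans (cong (C i ∘ leftAt i) un) (sym lab≡)
  edge-mates (extE i h) = # 2 , # 2 , refl , refl , refl

  mates : ∀ {x y} → Adj~ x y → Mates x y
  mates (inj₁ e) = edge-mates e
  mates (inj₂ e) = let i , j , eq , eq′ , lab≡ = edge-mates e in j , i , eq′ , eq , sym lab≡

  open PortColoring {Adj = Adj~} _≟ᵛ_ nbr lab nbr-injective lab-injective mates public

  -- Colour sets and normality.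

  colors⇒ : ∀ x c → ColorsAt coloring x c → ColorsAt σ (ψ x) c
  colors⇒ x c (w , xw , refl) with mates xw
  ... | i , _ , nbr≡ , _ = subst (ColorsAt σ (ψ x)) (sym (colour-nbr x i nbr≡)) (present (lab-palette x) i)

  colors⇐ : ∀ x c → ColorsAt σ (ψ x) c → ColorsAt coloring x c
  colors⇐ x c seen =
    let i , eq = exhausted (lab-palette x) c seen
    in nbr x i , nbr-adjacent x i , trans (colour-nbr x i refl) eq

  Near : Fin n → Fin n → Set
  Near a b = a ≡ b ⊎ Adj G a b

  near-sym : ∀ {a b} → Near a b → Near b a
  near-sym = Data.Sum.map sym (Adj-sym G)

  near-corner : ∀ i s → Near (u i) (corner i s)
  near-corner i L = inj₁ refl
  near-corner i R = inj₂ (u-next i)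

  near-corner′ : ∀ i s → Near (corner (prev i) s) (u i)
  near-corner′ i L = inj₂ (Adj-sym G (u-prev i))
  near-corner′ i R = inj₁ (cong u (next-prev i))

  near-corners : ∀ i s t → Near (corner i s) (corner i t)
  near-corners i L t = near-corner i t
  near-corners i R L = inj₂ (Adj-sym G (u-next i))
  near-corners i R R = inj₁ refl

  -- The critical case is a plain edge: it must not run from the left part of block i-1 to the right
  -- part of block i, as its image would then join u_{i-1} to u_{i+1}.
  edge-near : ∀ {x y} → E x y → Near (ψ x) (ψ y)
  edge-near (oldE ab _)             = inj₂ ab
  edge-near (innerE {i} {a} {b} _)  = near-corners i (part (S i) a) (part (S i) b)
  edge-near (dockL i j _)           = near-corner′ i (part (S (prev i)) (rightEnd j))
  edge-near (dockR i j _)           = near-corner i (part (S i) (leftEnd (key i j)))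
  edge-near (plainE i j h k≢d)      =
    near-plain (proj₂ (proj₂ (proj₂ (right-end i j)))) (proj₂ (proj₂ (proj₂ (left-end i (key i j)))))
    where
    near-plain : rightAt i (key i j) ≡ back ⊎ ψ (blkR i j) ≡ u i →
      leftAt i (key i j) ≡ fwd ⊎ ψ (blkL i (key i j)) ≡ u i →
      Near (ψ (blkR i j)) (ψ (blkL i (key i j)))
    near-plain (inj₂ eq) _ =
      subst (λ v → Near v (ψ (blkL i (key i j)))) (sym eq) (near-corner i (part (S i) (leftEnd (key i j))))
    near-plain (inj₁ _) (inj₂ eq) =
      subst (Near (ψ (blkR i j))) (sym eq) (near-corner′ i (part (S (prev i)) (rightEnd j)))
    -- A plain edge has the same name at both ends, so it cannot be `back` at one and `fwd` at the
    -- other.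
    near-plain (inj₁ rightAt≡back) (inj₁ leftAt≡fwd)
      with trans (sym rightAt≡back) (trans (plain-labels h (d i) (incoming i) (key i j) k≢d) leftAt≡fwd)
    ... | ()
  edge-near (subL i j _ _)          = near-corner′ i (part (S (prev i)) (rightEnd j))
  edge-near (subR i j _ _)          = near-corner i (part (S i) (leftEnd (key i j)))
  edge-near (extE i _)              = inj₁ refl

  -- Both ends show exactly the three colours of σ at their common image.
  poor-same : ∀ x y → ψ x ≡ ψ y → Poor coloring x y
  poor-same x y eq = lab x , distinct (lab-palette x) , λ c → seen c , λ { (i , refl) →
    inj₁ (colors⇐ x _ (present (lab-palette x) i)) }
    where
    seen : ∀ c → ColorsAt coloring x c ⊎ ColorsAt coloring y c → ∃[ i ] lab x i ≡ c
    seen c (inj₁ xc) = exhausted (lab-palette x) c (colors⇒ x c xc)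
    seen c (inj₂ yc) = exhausted (lab-palette x) c (subst (λ v → ColorsAt σ v c) (sym eq) (colors⇒ y c yc))

  union-size : ∀ x y {m} → UnionSize σ (ψ x) (ψ y) m → UnionSize coloring x y m
  union-size x y = HasSize-resp (λ c → Data.Sum.map (colors⇐ x c) (colors⇐ y c))
                                (λ c → Data.Sum.map (colors⇒ x c) (colors⇒ y c))

  coloring-normal : Normal σ → Normal coloring
  coloring-normal normal x y xy = go (near xy)
    where
    near : Adj~ x y → Near (ψ x) (ψ y)
    near (inj₁ e) = edge-near e
    near (inj₂ e) = near-sym (edge-near e)
    go : Near (ψ x) (ψ y) → Poor coloring x y ⊎ Rich coloring x y
    go (inj₁ eq) = inj₁ (poor-same x y eq)
    go (inj₂ ab) = Data.Sum.map (union-size x y) (union-size x y) (normal (ψ x) (ψ y) ab)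

  -- Eighteen poor edges in three blocks.

  block : Fin 3 → Fin g
  block b = inject≤ b 3≤g

  poorAt : Fin 3 → Fin 6 → V × V
  poorAt b e = let a , c = poorEdge (S (block b)) e in blk (block b) a , blk (block b) c

  poorAt-injective : ∀ b e b′ e′ → poorAt b e ≡ poorAt b′ e′ → b ≡ b′ × e ≡ e′
  poorAt-injective b e b′ e′ eq with inject≤-injective 3≤g 3≤g b b′ (proj₁ (blk-injective (cong proj₁ eq)))
  ... | refl = refl , proj₁ (poorEdge-distinct (S (block b)) e e′)
    (cong₂ _,_ (proj₂ (blk-injective (cong proj₁ eq))) (proj₂ (blk-injective (cong proj₂ eq))))

  poorAt-unswapped : ∀ b e b′ e′ → poorAt b e ≢ swap (poorAt b′ e′)
  poorAt-unswapped b e b′ e′ eq with inject≤-injective 3≤g 3≤g b b′ (proj₁ (blk-injective (cong proj₁ eq)))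
  ... | refl = proj₂ (poorEdge-distinct (S (block b)) e e′)
    (cong₂ _,_ (proj₂ (blk-injective (cong proj₁ eq))) (proj₂ (blk-injective (cong proj₂ eq))))

  coloring-poor : AtLeastPoor coloring 18
  coloring-poor = f , (λ i → poor (remQuot 6 i)) , λ i j i≢j →
    (λ eq → let b≡ , e≡ = poorAt-injective _ _ _ _ eq in
      i≢j (trans (sym (combine-remQuot 6 i)) (trans (cong₂ combine b≡ e≡) (combine-remQuot 6 j)))) ,
    poorAt-unswapped _ _ _ _
    where
    f : Fin 18 → V × V
    -- An index below 18 = 3 · 6 encodes one of three blocks and one of its six listed edges.
    f i = let b , e = remQuot {3} 6 i in poorAt b e
    poor : ∀ ((b , e) : Fin 3 × Fin 6) → let x , y = poorAt b e in Adj~ x y × Poor coloring x y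
    poor (b , e) = let i = block b ; adj , same = poorEdge-inner (S i) e
      in inj₁ (innerE adj) , poor-same _ _ (cong (corner i) same)

theorem3 : ∀ {n} (G : Graph n) → Snark G →
    (σ : EdgeColoring (Adj G) 5) → Normal σ →
    (g : ℕ) (u : Fin g → Fin n) → IsCycle G g u →
    (ty : Fin g → SType) (p : Fin g → Permutation′ 3) (d : Fin g → Fin 3) →
    (∃[ i ] ((p i ⟨$⟩ʳ zero) ≢ zero ⊎ d i ≢ zero)) →
    ∃[ σ~ ] (Normal {Adj = Superposition.Adj~ G g u ty p d} {k = 5} σ~ × AtLeastPoor σ~ 18)
theorem3 G (cubic , _) σ normal g u cyc ty p d odd =
  coloring , coloring-normal normal , coloring-poor
  where
  fitting = schemes ty p d odd
  open Build G cubic σ u cyc ty p d (proj₁ fitting) (proj₂ fitting)
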